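{- There exists a polynomial $p$ such that for every formula $F$ provable in $\mathbf{CL5}^-$, if $k$ denotes the size of $F$ (its length), then there exists a $\mathbf{CL5}^-$ proof of $F$ whose size is at most $p(k)$.
   Context: Formulas: built from (non-logical) atoms, taken from a countably infinite set, using $\neg$, $\wedge$, $\vee$, where $\neg$ may be applied only to atoms (no logical constants). A literal is an atom with or without prefix $\neg$. For a compound formula $F$, $\neg F$ abbreviates the De Morgan dual: $\neg\neg P$ is $P$, $\neg(A\wedge B)$ is $\neg A\vee\neg B$, $\neg(A\vee B)$ is $\neg A\wedge\neg B$. Cirquents: for $k\ge 0$, a $k$-ary cirquent is a pair $C=(\mathrm{St},\mathrm{Pl})$ where the pool $\mathrm{Pl}=\langle F_1,\dots,F_k\rangle$ is a sequence of formulas (repetitions allowed; each occurrence is called an oformula) and the structure $\mathrm{St}=\langle\Gamma_1,\dots,\Gamma_m\rangle$, $m\ge 0$, is a sequence of subsets of $\{1,\dots,k\}$ (repetitions allowed; each occurrence is called an ogroup). Ogroup $\Gamma_j$ contains oformula $F_i$ (there is an arc between them) iff $i\in\Gamma_j$. Two oformulas (or ogroups) are adjacent if they are consecutive in the pool (or structure). Merging two adjacent ogroups $\Gamma,\Delta$ means replacing them by the single ogroup $\Gamma\cup\Delta$. Merging two adjacent oformulas $F,G$ into $H$ means replacing them by the single oformula $H$, which is contained in exactly those ogroups that contained $F$ or $G$. The rules of $\mathbf{CL5}^-$ are: (A) Axioms (no premises): the empty cirquent (empty pool and empty structure); and, for any formula $F$, the identity axiom, i.e. the cirquent with pool $\langle\neg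 F,F\rangle$ and structure $\langle\{1,2\}\rangle$. (M) Mix (two premises): the conclusion is obtained by placing the two premises side by side (concatenating pools and structures, keeping arcs). (E) Exchange (one premise): swap two adjacent oformulas (preserving all arcs), or swap two adjacent ogroups (preserving all arcs). (W) Weakening (one premise): ogroup weakening adds one new arc between an existing ogroup and an existing oformula; pool weakening inserts a new oformula (contained in no ogroup) at any position of the pool. ($\vee$) $\vee$-introduction (one premise): merge two adjacent oformulas $F$ and $G$ ($G$ immediately after $F$) into $F\vee G$. ($\wedge$) $\wedge$-introduction (one premise): the premise has adjacent oformulas $F$, $G$ ($G$ immediately after $F$) such that no ogroup contains both, every ogroup containing $F$ is immediately followed by an ogroup containing $G$, and every ogroup containing $G$ is immediately preceded by an ogroup containing $F$; the conclusion is obtained by merging each ogroup containing $F$ with the ogroup containing $G$ that immediately follows it, and then merging $F$ and $G$ into $F\wedge G$. A $\mathbf{CL5}^-$ proof of a cirquent $C$ is a (finite) tree of cirquents with root $C$ in which each node follows from its children by one of the rules above. A proof of a formula $F$ is a proof of the cirquent with pool $\langle F\rangle$ and structure $\langle\{1\}\rangle$; $F$ is provable if it has a proof. Sizes: the length of a formula is the total number of occurrences of literals and connectives in it. The size of an ogroup is the number of oformulas it contains. The size of a cirquent is the sum of the lengths of the oformulas in its pool plus the sum of the sizes of its ogroups. The size of a proof is the sum of the sizes of the cirquents (nodes) it contains. -}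

module Defs where

open import Data.Bool.Base using (if_then_else_)
import Data.Bool.Base as Bool
open import Data.Fin.Base using (Fin; zero; suc; inject₁)
open import Data.Fin.Subset using (Subset; _∈_; _∉_; _∪_; ∣_∣; ⊤; ⊥; inside; outside)
open import Data.List.Base using (List; []; _∷_; _++_; _∷ʳ_; map)
import Data.List.Base as List
open import Data.List.Relation.Unary.All using (All)
open import Data.Nat.Base using (ℕ; zero; suc; _+_; _*_)
open import Data.Product.Base using (_×_; ∃₂)
open import Data.Vec.Base using (Vec; []; _∷_; lookup; insertAt; _[_]≔_)
import Data.Vec.Base as Vec
open import Relation.Binary.PropositionalEquality.Core using (_≡_)
open import Relation.Nullary.Negation.Core using (¬_)

private
  variable
    k l n : ℕ

infixr 7 _∧_
infixr 6 _∨_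

-- Atoms are natural numbers; `pos a` and `neg a` are the literals a and ¬ a.
data Formula : Set where
  pos neg : (a : ℕ) → Formula
  _∧_ _∨_ : (A B : Formula) → Formula

dual : Formula → Formula
dual (pos a) = neg a
dual (neg a) = pos a
dual (A ∧ B) = dual A ∨ dual B
dual (A ∨ B) = dual A ∧ dual B

-- A negated atom is a single literal and so has length 1.
length : Formula → ℕ
length (pos a) = 1
length (neg a) = 1
length (A ∧ B) = suc (length A + length B)
length (A ∨ B) = suc (length A + length B)

Ogroup : ℕ → Set
Ogroup = Subset

Structure : ℕ → Set
Structure k = List (Ogroup k)

Pool : ℕ → Set
Pool k = Vec Formula k

record Cirquent (k : ℕ) : Set where
  constructor ⟨_,_⟩
  field
    structure : Structure k
    pool      : Pool k

-- A position i : Fin (suc n) in a vector of length 2 + n stands for the pair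
-- of adjacent entries at inject₁ i and suc i.  The operations below act both
-- on pools and, through membership bits, on ogroups.

swapAt : {A : Set} → Fin (suc n) → Vec A (suc (suc n)) → Vec A (suc (suc n))
swapAt             zero    (x ∷ y ∷ xs) = y ∷ x ∷ xs
swapAt {n = suc _} (suc i) (x ∷ xs)     = x ∷ swapAt i xs

mergeAt : {A : Set} → (A → A → A) → Fin (suc n) → Vec A (suc (suc n)) → Vec A (suc n)
mergeAt             f zero    (x ∷ y ∷ xs) = f x y ∷ xs
mergeAt {n = suc _} f (suc i) (x ∷ xs)     = x ∷ mergeAt f i xs

mergeOformulas : (Formula → Formula → Formula) → Fin (suc n) →
                 Cirquent (suc (suc n)) → Cirquent (suc n)
mergeOformulas _∘_ i ⟨ St , Pl ⟩ =
  ⟨ map (mergeAt Bool._∨_ i) St , mergeAt _∘_ i Pl ⟩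

_∥_ : Cirquent k → Cirquent l → Cirquent (k + l)
⟨ St₁ , Pl₁ ⟩ ∥ ⟨ St₂ , Pl₂ ⟩ =
  ⟨ map (Vec._++ ⊥) St₁ ++ map (⊥ Vec.++_) St₂ , Pl₁ Vec.++ Pl₂ ⟩

EachFollowed : (i j : Fin k) → Structure k → Set
EachFollowed i j St = ∀ Φ Γ Ψ → St ≡ Φ ++ Γ ∷ Ψ → i ∈ Γ →
  ∃₂ λ Δ Ψ′ → Ψ ≡ Δ ∷ Ψ′ × j ∈ Δ

EachPreceded : (i j : Fin k) → Structure k → Set
EachPreceded i j St = ∀ Φ Δ Ψ → St ≡ Φ ++ Δ ∷ Ψ → j ∈ Δ →
  ∃₂ λ Φ′ Γ → Φ ≡ Φ′ ∷ʳ Γ × i ∈ Γ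

record ∧-Premise (i j : Fin k) (St : Structure k) : Set where
  field
    disjoint : All (λ Γ → ¬ (i ∈ Γ × j ∈ Γ)) St
    followed : EachFollowed i j St
    preceded : EachPreceded i j St

-- Merges each ogroup containing i with its successor.  It is only used under
-- ∧-Premise i j, where that successor exists, contains j and does not contain i.
mergeOgroups : Fin k → Structure k → Structure k
mergeOgroups i []           = []
mergeOgroups i (Γ ∷ [])     = Γ ∷ []
mergeOgroups i (Γ ∷ Δ ∷ St) =
  if lookup Γ i then (Γ ∪ Δ) ∷ mergeOgroups i St
                else Γ ∷ mergeOgroups i (Δ ∷ St)

infix 4 _⟶_

-- C ⟶ D : the cirquent D follows from C by a one-premise rule.
data _⟶_ : Cirquent k → Cirquent l → Set where
  oformula-exchange : (i : Fin (suc n)) (St : Structure (suc (suc n))) (Pl : Pool (suc (suc n))) →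
    ⟨ St , Pl ⟩ ⟶ ⟨ map (swapAt i) St , swapAt i Pl ⟩
  ogroup-exchange : (Φ : Structure k) (Γ Δ : Ogroup k) (Ψ : Structure k) (Pl : Pool k) →
    ⟨ Φ ++ Γ ∷ Δ ∷ Ψ , Pl ⟩ ⟶ ⟨ Φ ++ Δ ∷ Γ ∷ Ψ , Pl ⟩
  ogroup-weakening : (Φ : Structure k) (Γ : Ogroup k) (Ψ : Structure k) (Pl : Pool k) (i : Fin k) →
    i ∉ Γ →
    ⟨ Φ ++ Γ ∷ Ψ , Pl ⟩ ⟶ ⟨ Φ ++ (Γ [ i ]≔ inside) ∷ Ψ , Pl ⟩
  pool-weakening : (St : Structure k) (Pl : Pool k) (i : Fin (suc k)) (F : Formula) →
    ⟨ St , Pl ⟩ ⟶ ⟨ map (λ Γ → insertAt Γ i outside) St , insertAt Pl i F ⟩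
  ∨-introduction : (i : Fin (suc n)) (St : Structure (suc (suc n))) (Pl : Pool (suc (suc n))) →
    ⟨ St , Pl ⟩ ⟶ mergeOformulas _∨_ i ⟨ St , Pl ⟩
  ∧-introduction : (i : Fin (suc n)) (St : Structure (suc (suc n))) (Pl : Pool (suc (suc n))) →
    ∧-Premise (inject₁ i) (suc i) St →
    ⟨ St , Pl ⟩ ⟶ mergeOformulas _∧_ i ⟨ mergeOgroups (inject₁ i) St , Pl ⟩

data Proof : Cirquent k → Set where
  empty    : Proof ⟨ [] , [] ⟩
  identity : (F : Formula) → Proof ⟨ ⊤ ∷ [] , dual F ∷ F ∷ [] ⟩
  mix      : {C : Cirquent k} {D : Cirquent l} → Proof C → Proof D → Proof (C ∥ D)
  step     : {C : Cirquent k} {D : Cirquent l} → C ⟶ D → Proof C → Proof D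

FormulaProof : Formula → Set
FormulaProof F = Proof ⟨ ⊤ ∷ [] , F ∷ [] ⟩

Provable : Formula → Set
Provable = FormulaProof

cirquentSize : Cirquent k → ℕ
cirquentSize ⟨ St , Pl ⟩ = Vec.sum (Vec.map length Pl) + List.sum (map ∣_∣ St)

proofSize : {C : Cirquent k} → Proof C → ℕ
proofSize {C = C} empty        = cirquentSize C
proofSize {C = C} (identity F) = cirquentSize C
proofSize {C = C} (mix π ρ)    = cirquentSize C + (proofSize π + proofSize ρ)
proofSize {C = C} (step r π)   = cirquentSize C + proofSize π

-- Coefficients, constant term first.
Polynomial : Set
Polynomial = List ℕ

eval : Polynomial → ℕ → ℕ
eval []      x = 0
eval (c ∷ p) x = c + x * eval p x

{-# OPTIONS --safe #-}
-- Read from the axioms downwards, no rule ever deletes an oformula or an ogroup, and every ogroup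
-- descends from an identity axiom; hence a derivable cirquent has at most as many ogroups as the
-- total length of its pool, and all cirquents in a proof of F have size at most quadratic in |F|.
-- Every rule other than exchange and ogroup weakening increases the total length of the pool (for
-- mix: once mixes with the empty cirquent are discarded), and ogroup weakening increases the number
-- of arcs, so only polynomially many non-exchange steps occur.  Finally, a run of exchanges between
-- two such steps amounts to a permutation of the pool and one of the structure, which quadratically
-- many exchanges achieve.
module Submission where

open import Defs
open import Data.Bool.Base using (true; false)
open import Data.Empty using (⊥-elim)
open import Data.Fin.Base using (Fin; zero; suc; inject₁)
open import Data.Fin.Subset using (_∉_; ∣_∣; ⊥; ⊤; inside)
open import Data.Fin.Subset.Properties using (∣p∣≤n)
open import Data.List.Base as List using (List; []; _∷_; _++_; map)
open import Data.List.Properties using (length-map; length-++; map-id; map-cong; map-∘; ++-identityʳ)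
open import Data.List.Membership.Propositional.Properties using (∈-∃++)
open import Data.List.Relation.Binary.Permutation.Propositional as ↭ using (_↭_; ↭-refl; ↭-reflexive; ↭-trans)
open import Data.List.Relation.Binary.Permutation.Propositional.Properties using (∈-resp-↭; drop-mid; ↭-length; map⁺; ++⁺ˡ)
open import Data.List.Relation.Unary.Any using (here)
open import Data.Nat.Base using (ℕ; zero; suc; _+_; _*_; _≤_; z≤n; s≤s)
open import Data.Nat.ListAction using (sum)
open import Data.Nat.ListAction.Properties using (sum-↭)
open import Data.Nat.Properties
open import Data.Nat.Tactic.RingSolver using (solve-∀)
open import Data.Product.Base using (Σ-syntax; ∃-syntax; _×_; _,_)
open import Data.Sum.Base using (_⊎_; inj₁; inj₂)
open import Data.Vec.Base as Vec using (Vec; []; _∷_; insertAt; _[_]≔_)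
open import Data.Vec.Properties using (cast-is-id; ++-identityʳ-eqFree)
open import Relation.Binary.PropositionalEquality

open Cirquent

private
  variable
    k l n : ℕ
    A : Set

-- Permutations of the pool

-- Indexing by the full length makes `Swap 0` and `Swap 1` empty, so words of swaps make sense for
-- pools of every arity.
data Swap : ℕ → Set where
  at : Fin (suc n) → Swap (suc (suc n))

raise : Swap n → Swap (suc n)
raise (at i) = at (suc i)

swap : Swap n → Vec A n → Vec A n
swap (at i) = swapAt i

swaps : List (Swap n) → Vec A n → Vec A n
swaps []      xs = xs
swaps (s ∷ w) xs = swaps w (swap s xs)

swap-raise : (s : Swap n) (x : A) (xs : Vec A n) → swap (raise s) (x ∷ xs) ≡ x ∷ swap s xs
swap-raise (at i) x xs = refl

swaps-raise : (w : List (Swap n)) (x : A) (xs : Vec A n) → swaps (map raise w) (x ∷ xs) ≡ x ∷ swaps w xs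
swaps-raise []      x xs = refl
swaps-raise (s ∷ w) x xs = trans (cong (swaps (map raise w)) (swap-raise s x xs)) (swaps-raise w x (swap s xs))

swaps-++ : (v w : List (Swap n)) (xs : Vec A n) → swaps (v ++ w) xs ≡ swaps w (swaps v xs)
swaps-++ []      w xs = refl
swaps-++ (s ∷ v) w xs = swaps-++ v w (swap s xs)

-- Lehmer codes: the head of the vector goes to the given position of the permuted tail.
data Code : ℕ → Set where
  []  : Code 0
  _∷_ : Fin (suc n) → Code n → Code (suc n)

permute : Code n → Vec A n → Vec A n
permute []      []       = []
permute (p ∷ c) (x ∷ xs) = insertAt (permute c xs) p x

idCode : Code n
idCode {zero}  = []
idCode {suc n} = zero ∷ idCode

permute-id : (xs : Vec A n) → permute idCode xs ≡ xs
permute-id []       = refl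
permute-id (x ∷ xs) = cong (x ∷_) (permute-id xs)

-- Either the transposition involves the inserted entry, which then moves to a neighbouring position
-- `q`, or it exchanges two other entries, which are adjacent in `xs` as well.
swapAt-insertAt : (i : Fin (suc n)) (p : Fin (suc (suc n))) →
  (Σ[ q ∈ Fin (suc (suc n)) ] (∀ {A : Set} (xs : Vec A (suc n)) x →
    swapAt i (insertAt xs p x) ≡ insertAt xs q x)) ⊎
  (Σ[ s ∈ Swap (suc n) ] (∀ {A : Set} (xs : Vec A (suc n)) x →
    swapAt i (insertAt xs p x) ≡ insertAt (swap s xs) p x))
swapAt-insertAt zero zero = inj₁ (suc zero , λ { (y ∷ xs) x → refl })
swapAt-insertAt zero (suc zero) = inj₁ (zero , λ { (y ∷ xs) x → refl })
swapAt-insertAt {suc n} zero (suc (suc p)) = inj₂ (at zero , λ { (y ∷ z ∷ xs) x → refl })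
swapAt-insertAt {suc n} (suc i) zero = inj₂ (at i , λ xs x → refl)
swapAt-insertAt {suc n} (suc i) (suc p) with swapAt-insertAt i p
... | inj₁ (q , eq) = inj₁ (suc q , λ { (y ∷ xs) x → cong (y ∷_) (eq xs x) })
... | inj₂ (s , eq) = inj₂ (raise s , λ { (y ∷ xs) x →
  trans (cong (y ∷_) (eq xs x)) (cong (λ zs → insertAt zs (suc p) x) (sym (swap-raise s y xs))) })

-- A code absorbs an exchange without growing. The equation is uniform in `A` because the same code
-- must act on the formulas of the pool and on the membership bits of the ogroups.
swapCode : (s : Swap n) (c : Code n) →
  Σ[ d ∈ Code n ] (∀ {A : Set} (xs : Vec A n) → permute d xs ≡ swap s (permute c xs))
swapCode (at i) (p ∷ c) with swapAt-insertAt i p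
... | inj₁ (q , eq) = q ∷ c , λ { (x ∷ xs) → sym (eq (permute c xs) x) }
... | inj₂ (s , eq) with swapCode s c
...   | d , eq′ = p ∷ d , λ { (x ∷ xs) →
  trans (cong (λ ys → insertAt ys p x) (eq′ xs)) (sym (eq (permute c xs) x)) }

insertion : Fin (suc n) → List (Swap (suc n))
insertion         zero    = []
insertion {suc n} (suc p) = at zero ∷ map raise (insertion p)

swaps-insertion : (p : Fin (suc n)) (x : A) (xs : Vec A n) → swaps (insertion p) (x ∷ xs) ≡ insertAt xs p x
swaps-insertion zero    x xs       = refl
swaps-insertion (suc p) x (y ∷ xs) =
  trans (swaps-raise (insertion p) y (x ∷ xs)) (cong (y ∷_) (swaps-insertion p x xs))

length-insertion : (p : Fin (suc n)) → List.length (insertion p) ≤ n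
length-insertion         zero    = z≤n
length-insertion {suc n} (suc p) = s≤s (≤-trans (≤-reflexive (length-map raise (insertion p))) (length-insertion p))

word : Code n → List (Swap n)
word []      = []
word (p ∷ c) = map raise (word c) ++ insertion p

swaps-word : (c : Code n) (xs : Vec A n) → swaps (word c) xs ≡ permute c xs
swaps-word []      []       = refl
swaps-word (p ∷ c) (x ∷ xs) = begin
  swaps (map raise (word c) ++ insertion p) (x ∷ xs)           ≡⟨ swaps-++ (map raise (word c)) (insertion p) (x ∷ xs) ⟩
  swaps (insertion p) (swaps (map raise (word c)) (x ∷ xs))    ≡⟨ cong (swaps (insertion p)) (swaps-raise (word c) x xs) ⟩
  swaps (insertion p) (x ∷ swaps (word c) xs)                  ≡⟨ swaps-insertion p x _ ⟩
  insertAt (swaps (word c) xs) p x                             ≡⟨ cong (λ ys → insertAt ys p x) (swaps-word c xs) ⟩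
  insertAt (permute c xs) p x                                  ∎
  where open ≡-Reasoning

n²+m≤[1+n]² : ∀ {a m} n → a ≤ n * n → m ≤ n → a + m ≤ suc n * suc n
n²+m≤[1+n]² n a≤ m≤ = ≤-trans (+-mono-≤ a≤ m≤)
  (≤-trans (m≤m+n (n * n + n) (suc n)) (≤-reflexive (square-suc n)))
  where
  square-suc : ∀ n → n * n + n + suc n ≡ suc n * suc n
  square-suc = solve-∀

length-word : (c : Code n) → List.length (word c) ≤ n * n
length-word [] = z≤n
length-word {suc n} (p ∷ c) = begin
  List.length (map raise (word c) ++ insertion p)                  ≡⟨ length-++ (map raise (word c)) ⟩
  List.length (map raise (word c)) + List.length (insertion p)     ≡⟨ cong (_+ _) (length-map raise (word c)) ⟩
  List.length (word c) + List.length (insertion p)                 ≤⟨ n²+m≤[1+n]² n (length-word c) (length-insertion p) ⟩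
  suc n * suc n                                                    ∎
  where open ≤-Reasoning

-- Permutations of the structure

-- The index counts exchanges, and the shape of `then` is that of `ogroup-exchange`.
data Swaps {A : Set} : ℕ → List A → List A → Set where
  done : ∀ {xs} → Swaps 0 xs xs
  then : ∀ {n zs} (xs : List A) (x y : A) (ys : List A) →
    Swaps n (xs ++ y ∷ x ∷ ys) zs → Swaps (suc n) (xs ++ x ∷ y ∷ ys) zs

Swaps-∷ : ∀ {xs ys} (x : A) → Swaps n xs ys → Swaps n (x ∷ xs) (x ∷ ys)
Swaps-∷ x done             = done
Swaps-∷ x (then xs y z ys w) = then (x ∷ xs) y z ys (Swaps-∷ x w)

Swaps-trans : ∀ {m xs ys zs} → Swaps {A} m xs ys → Swaps n ys zs → Swaps (m + n) xs zs
Swaps-trans done               w = w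
Swaps-trans (then xs x y ys v) w = then xs x y ys (Swaps-trans v w)

bubble : (x : A) (xs ys : List A) → Swaps (List.length xs) (x ∷ xs ++ ys) (xs ++ x ∷ ys)
bubble x []       ys = done
bubble x (z ∷ xs) ys = then [] x z (xs ++ ys) (Swaps-∷ z (bubble x xs ys))

-- Insertion sort towards the target: arrange the tail first, then bubble the head past `ps`. The
-- derivation `σ`, whose length is uncontrolled, only serves to locate the head in the target and to
-- delete it there.
↭⇒Swaps : (xs ys : List A) → xs ↭ ys → ∃[ n ] n ≤ List.length xs * List.length xs × Swaps n xs ys
↭⇒Swaps []       []       σ = 0 , z≤n , done
↭⇒Swaps []       (y ∷ ys) σ with () ← ↭-length σ
↭⇒Swaps (x ∷ xs) zs σ with ∈-∃++ (∈-resp-↭ σ (here refl))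
... | ps , qs , refl =
  let τ = drop-mid [] ps σ
      m , m≤ , w = ↭⇒Swaps xs (ps ++ qs) τ
      ∣ps∣≤∣xs∣ = ≤-trans (m≤m+n _ (List.length qs))
                    (≤-reflexive (trans (sym (length-++ ps)) (sym (↭-length τ))))
  in m + List.length ps
   , n²+m≤[1+n]² (List.length xs) m≤ ∣ps∣≤∣xs∣
   , Swaps-trans (Swaps-∷ x w) (bubble x ps qs)

-- Weights and arcs

weight : Pool k → ℕ
weight Pl = Vec.sum (Vec.map length Pl)

arcs : Structure k → ℕ
arcs St = sum (map ∣_∣ St)

length-pos : (F : Formula) → 1 ≤ length F
length-pos (pos a) = s≤s z≤n
length-pos (neg a) = s≤s z≤n
length-pos (F ∧ G) = s≤s z≤n
length-pos (F ∨ G) = s≤s z≤n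

arity≤weight : (Pl : Pool k) → k ≤ weight Pl
arity≤weight []       = z≤n
arity≤weight (F ∷ Pl) = +-mono-≤ (length-pos F) (arity≤weight Pl)

comm-left : ∀ x y z → x + (y + z) ≡ y + (x + z)
comm-left = solve-∀

+-swapˡ : ∀ x y z → x + y + z ≡ y + (x + z)
+-swapˡ = solve-∀

weight-swapAt : (i : Fin (suc n)) (Pl : Pool (suc (suc n))) → weight (swapAt i Pl) ≡ weight Pl
weight-swapAt zero (F ∷ G ∷ Pl) = comm-left (length G) (length F) (weight Pl)
weight-swapAt {suc n} (suc i) (F ∷ Pl) = cong (length F +_) (weight-swapAt i Pl)

weight-insertAt : (Pl : Pool k) (i : Fin (suc k)) (F : Formula) → weight (insertAt Pl i F) ≡ length F + weight Pl
weight-insertAt Pl       zero    F = refl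
weight-insertAt (G ∷ Pl) (suc i) F =
  trans (cong (length G +_) (weight-insertAt Pl i F)) (comm-left (length G) (length F) (weight Pl))

weight-mergeAt : ∀ _∘_ → (∀ F G → length (F ∘ G) ≡ suc (length F + length G)) →
  (i : Fin (suc n)) (Pl : Pool (suc (suc n))) → weight (mergeAt _∘_ i Pl) ≡ suc (weight Pl)
weight-mergeAt _∘_ eq zero (F ∷ G ∷ Pl) =
  trans (cong (_+ weight Pl) (eq F G)) (cong suc (+-assoc (length F) (length G) (weight Pl)))
weight-mergeAt {suc n} _∘_ eq (suc i) (F ∷ Pl) =
  trans (cong (length F +_) (weight-mergeAt _∘_ eq i Pl)) (+-suc (length F) (weight Pl))

weight-++ : (Pl : Pool k) (Pl′ : Pool l) → weight (Pl Vec.++ Pl′) ≡ weight Pl + weight Pl′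
weight-++ []       Pl′ = refl
weight-++ (F ∷ Pl) Pl′ = trans (cong (length F +_) (weight-++ Pl Pl′)) (sym (+-assoc (length F) _ _))

∣swapAt∣ : (i : Fin (suc n)) (Γ : Ogroup (suc (suc n))) → ∣ swapAt i Γ ∣ ≡ ∣ Γ ∣
∣swapAt∣ zero (true  ∷ true  ∷ Γ) = refl
∣swapAt∣ zero (true  ∷ false ∷ Γ) = refl
∣swapAt∣ zero (false ∷ true  ∷ Γ) = refl
∣swapAt∣ zero (false ∷ false ∷ Γ) = refl
∣swapAt∣ {suc n} (suc i) (true  ∷ Γ) = cong suc (∣swapAt∣ i Γ)
∣swapAt∣ {suc n} (suc i) (false ∷ Γ) = ∣swapAt∣ i Γ

∣[]≔inside∣ : (Γ : Ogroup k) (i : Fin k) → i ∉ Γ → ∣ Γ [ i ]≔ inside ∣ ≡ suc ∣ Γ ∣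
∣[]≔inside∣ (true  ∷ Γ) zero    i∉Γ = ⊥-elim (i∉Γ Vec.here)
∣[]≔inside∣ (false ∷ Γ) zero    i∉Γ = refl
∣[]≔inside∣ (true  ∷ Γ) (suc i) i∉Γ = cong suc (∣[]≔inside∣ Γ i (λ i∈Γ → i∉Γ (Vec.there i∈Γ)))
∣[]≔inside∣ (false ∷ Γ) (suc i) i∉Γ = ∣[]≔inside∣ Γ i (λ i∈Γ → i∉Γ (Vec.there i∈Γ))

∣++∣ˡ : (Γ : Ogroup k) (Δ : Ogroup l) → ∣ Γ ∣ ≤ ∣ Γ Vec.++ Δ ∣
∣++∣ˡ []          Δ = z≤n
∣++∣ˡ (true  ∷ Γ) Δ = s≤s (∣++∣ˡ Γ Δ)
∣++∣ˡ (false ∷ Γ) Δ = ∣++∣ˡ Γ Δ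

∣++∣ʳ : (Γ : Ogroup k) (Δ : Ogroup l) → ∣ Δ ∣ ≤ ∣ Γ Vec.++ Δ ∣
∣++∣ʳ []          Δ = ≤-refl
∣++∣ʳ (true  ∷ Γ) Δ = m≤n⇒m≤1+n (∣++∣ʳ Γ Δ)
∣++∣ʳ (false ∷ Γ) Δ = ∣++∣ʳ Γ Δ

arcs-map : {f : Ogroup k → Ogroup l} → (∀ Γ → ∣ Γ ∣ ≤ ∣ f Γ ∣) → (St : Structure k) → arcs St ≤ arcs (map f St)
arcs-map le []       = z≤n
arcs-map le (Γ ∷ St) = +-mono-≤ (le Γ) (arcs-map le St)

arcs-++ : (Φ Ψ : Structure k) → arcs (Φ ++ Ψ) ≡ arcs Φ + arcs Ψ
arcs-++ []      Ψ = refl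
arcs-++ (Γ ∷ Φ) Ψ = trans (cong (∣ Γ ∣ +_) (arcs-++ Φ Ψ)) (sym (+-assoc ∣ Γ ∣ _ _))

arcs-swapAt : (i : Fin (suc n)) (St : Structure (suc (suc n))) → arcs (map (swapAt i) St) ≡ arcs St
arcs-swapAt i []       = refl
arcs-swapAt i (Γ ∷ St) = cong₂ _+_ (∣swapAt∣ i Γ) (arcs-swapAt i St)

arcs-↭ : {St St′ : Structure k} → St ↭ St′ → arcs St ≡ arcs St′
arcs-↭ σ = sum-↭ (map⁺ ∣_∣ σ)

exchange-↭ : (Φ : List A) (x y : A) (Ψ : List A) → Φ ++ x ∷ y ∷ Ψ ↭ Φ ++ y ∷ x ∷ Ψ
exchange-↭ Φ x y Ψ = ++⁺ˡ Φ (↭.swap x y ↭-refl)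

arcs-weakening : (Φ : Structure k) (Γ : Ogroup k) (Ψ : Structure k) (i : Fin k) → i ∉ Γ →
  arcs (Φ ++ (Γ [ i ]≔ inside) ∷ Ψ) ≡ suc (arcs (Φ ++ Γ ∷ Ψ))
arcs-weakening []      Γ Ψ i i∉Γ = cong (_+ arcs Ψ) (∣[]≔inside∣ Γ i i∉Γ)
arcs-weakening (Δ ∷ Φ) Γ Ψ i i∉Γ =
  trans (cong (∣ Δ ∣ +_) (arcs-weakening Φ Γ Ψ i i∉Γ)) (+-suc ∣ Δ ∣ _)

arcs≤ : (St : Structure k) → arcs St ≤ List.length St * k
arcs≤ []       = z≤n
arcs≤ (Γ ∷ St) = +-mono-≤ (∣p∣≤n Γ) (arcs≤ St)

arcs-∥ : (C : Cirquent k) (D : Cirquent l) → arcs (structure C) + arcs (structure D) ≤ arcs (structure (C ∥ D))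
arcs-∥ {k} {l} C D = ≤-trans
  (+-mono-≤ (arcs-map (λ Γ → ∣++∣ˡ Γ ⊥) (structure C)) (arcs-map (λ Γ → ∣++∣ʳ (⊥ {k}) Γ) (structure D)))
  (≤-reflexive (sym (arcs-++ (map (Vec._++ ⊥) (structure C)) (map (⊥ Vec.++_) (structure D)))))

-- Bounding the number of ogroups

length-mergeOgroups : (i : Fin k) (St : Structure k) → List.length (mergeOgroups i St) ≤ List.length St
length-mergeOgroups i []           = z≤n
length-mergeOgroups i (Γ ∷ [])     = ≤-refl
length-mergeOgroups i (Γ ∷ Δ ∷ St)
  with Vec.lookup Γ i | length-mergeOgroups i St | length-mergeOgroups i (Δ ∷ St)
... | true  | ≤₁ | _  = s≤s (m≤n⇒m≤1+n ≤₁)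
... | false | _  | ≤₂ = s≤s ≤₂

length-replace : (Φ : List A) (x y : A) (Ψ : List A) → List.length (Φ ++ x ∷ Ψ) ≡ List.length (Φ ++ y ∷ Ψ)
length-replace []      x y Ψ = refl
length-replace (_ ∷ Φ) x y Ψ = cong suc (length-replace Φ x y Ψ)

-- Each ogroup descends from an identity axiom, whose two oformulas are its own.
ogroups≤weight : {C : Cirquent k} → Proof C → List.length (structure C) ≤ weight (pool C)
ogroups≤weight empty = z≤n
ogroups≤weight (identity F) = ≤-trans (length-pos (dual F)) (m≤m+n _ _)
ogroups≤weight (mix {C = C} {D} π ρ) = begin
  List.length (map (Vec._++ ⊥) (structure C) ++ map (⊥ Vec.++_) (structure D))  ≡⟨ length-++ (map (Vec._++ ⊥) (structure C)) ⟩
  List.length (map (Vec._++ ⊥) (structure C)) + List.length (map (⊥ Vec.++_) (structure D))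
    ≡⟨ cong₂ _+_ (length-map (Vec._++ ⊥) (structure C)) (length-map (⊥ Vec.++_) (structure D)) ⟩
  List.length (structure C) + List.length (structure D)                        ≤⟨ +-mono-≤ (ogroups≤weight π) (ogroups≤weight ρ) ⟩
  weight (pool C) + weight (pool D)                                            ≡⟨ weight-++ (pool C) (pool D) ⟨
  weight (pool C Vec.++ pool D)                                                ∎
  where open ≤-Reasoning
ogroups≤weight (step (oformula-exchange i St Pl) π) =
  subst₂ _≤_ (sym (length-map (swapAt i) St)) (sym (weight-swapAt i Pl)) (ogroups≤weight π)
ogroups≤weight (step (ogroup-exchange Φ Γ Δ Ψ Pl) π) =
  subst (_≤ _) (↭-length (exchange-↭ Φ Γ Δ Ψ)) (ogroups≤weight π)
ogroups≤weight (step (ogroup-weakening Φ Γ Ψ Pl i i∉Γ) π) =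
  subst (_≤ _) (length-replace Φ Γ (Γ [ i ]≔ inside) Ψ) (ogroups≤weight π)
ogroups≤weight (step (pool-weakening St Pl i F) π) =
  subst₂ _≤_ (sym (length-map _ St)) (sym (weight-insertAt Pl i F)) (m≤n⇒m≤o+n (length F) (ogroups≤weight π))
ogroups≤weight (step (∨-introduction i St Pl) π) =
  subst₂ _≤_ (sym (length-map _ St)) (sym (weight-mergeAt _∨_ (λ _ _ → refl) i Pl)) (m≤n⇒m≤1+n (ogroups≤weight π))
ogroups≤weight (step (∧-introduction i St Pl _) π) =
  subst₂ _≤_ (sym (length-map _ (mergeOgroups (inject₁ i) St))) (sym (weight-mergeAt _∧_ (λ _ _ → refl) i Pl))
    (m≤n⇒m≤1+n (≤-trans (length-mergeOgroups (inject₁ i) St) (ogroups≤weight π)))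

-- Performing a permutation by exchanges

-- Exchanges preserve weight and arcs, so every cirquent added has the size of the first one.
performSwaps : (w : List (Swap k)) (St : Structure k) (Pl : Pool k) (π : Proof ⟨ St , Pl ⟩) →
  Σ[ ρ ∈ Proof ⟨ map (swaps w) St , swaps w Pl ⟩ ]
    proofSize ρ ≡ proofSize π + List.length w * cirquentSize ⟨ St , Pl ⟩
performSwaps [] St Pl π =
  subst (λ St′ → Σ[ ρ ∈ Proof ⟨ St′ , Pl ⟩ ] proofSize ρ ≡ proofSize π + 0)
    (sym (map-id St)) (π , sym (+-identityʳ _))
performSwaps (at i ∷ w) St Pl π with performSwaps w _ _ (step (oformula-exchange i St Pl) π)
... | ρ , eq =
  subst (λ St′ → Σ[ ρ′ ∈ Proof ⟨ St′ , swaps w (swapAt i Pl) ⟩ ] proofSize ρ′ ≡ proofSize π + suc (List.length w) * s)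
    (sym (map-∘ St))
    (ρ , trans eq (trans (cong (λ t → t + proofSize π + List.length w * t) size-eq) (+-swapˡ s (proofSize π) (List.length w * s))))
  where
  s = cirquentSize ⟨ St , Pl ⟩
  size-eq : cirquentSize ⟨ map (swapAt i) St , swapAt i Pl ⟩ ≡ s
  size-eq = cong₂ _+_ (weight-swapAt i Pl) (arcs-swapAt i St)

performCode : (c : Code k) (St : Structure k) (Pl : Pool k) (π : Proof ⟨ St , Pl ⟩) →
  Σ[ ρ ∈ Proof ⟨ map (permute c) St , permute c Pl ⟩ ]
    proofSize ρ ≡ proofSize π + List.length (word c) * cirquentSize ⟨ St , Pl ⟩
performCode c St Pl π =
  subst₂ (λ St′ Pl′ → Σ[ ρ ∈ Proof ⟨ St′ , Pl′ ⟩ ] proofSize ρ ≡ proofSize π + List.length (word c) * cirquentSize ⟨ St , Pl ⟩)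
    (map-cong (swaps-word c) St) (swaps-word c Pl) (performSwaps (word c) St Pl π)

performOgroupSwaps : {St St′ : Structure k} {Pl : Pool k} → Swaps n St St′ → (π : Proof ⟨ St , Pl ⟩) →
  Σ[ ρ ∈ Proof ⟨ St′ , Pl ⟩ ] proofSize ρ ≡ proofSize π + n * cirquentSize ⟨ St′ , Pl ⟩
performOgroupSwaps done π = π , sym (+-identityʳ _)
performOgroupSwaps {St′ = St′} {Pl} (then {n} Φ Γ Δ Ψ w) π
  with performOgroupSwaps w (step (ogroup-exchange Φ Γ Δ Ψ Pl) π)
... | ρ , eq = ρ , trans eq
  (trans (cong (λ t → t + proofSize π + n * s) (cong (weight Pl +_) (arcs-Swaps w)))
         (+-swapˡ s (proofSize π) (n * s)))
  where
  s = cirquentSize ⟨ St′ , Pl ⟩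
  arcs-Swaps : ∀ {m Φ Ψ} → Swaps m Φ Ψ → arcs Φ ≡ arcs Ψ
  arcs-Swaps done = refl
  arcs-Swaps (then Φ Γ Δ Ψ w) = trans (arcs-↭ (exchange-↭ Φ Γ Δ Ψ)) (arcs-Swaps w)

weight-permute : (c : Code k) (Pl : Pool k) → weight (permute c Pl) ≡ weight Pl
weight-permute []      []       = refl
weight-permute (p ∷ c) (F ∷ Pl) =
  trans (weight-insertAt (permute c Pl) p F) (cong (length F +_) (weight-permute c Pl))

∣insertAt∣ : (Γ : Ogroup k) (p : Fin (suc k)) (b : _) → ∣ insertAt Γ p b ∣ ≡ ∣ b ∷ Γ ∣
∣insertAt∣ Γ           zero    b     = refl
∣insertAt∣ (true  ∷ Γ) (suc p) true  = cong suc (∣insertAt∣ Γ p true)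
∣insertAt∣ (true  ∷ Γ) (suc p) false = cong suc (∣insertAt∣ Γ p false)
∣insertAt∣ (false ∷ Γ) (suc p) true  = ∣insertAt∣ Γ p true
∣insertAt∣ (false ∷ Γ) (suc p) false = ∣insertAt∣ Γ p false

∣permute∣ : (c : Code k) (Γ : Ogroup k) → ∣ permute c Γ ∣ ≡ ∣ Γ ∣
∣permute∣ []      []          = refl
∣permute∣ (p ∷ c) (true  ∷ Γ) = trans (∣insertAt∣ (permute c Γ) p true) (cong suc (∣permute∣ c Γ))
∣permute∣ (p ∷ c) (false ∷ Γ) = trans (∣insertAt∣ (permute c Γ) p false) (∣permute∣ c Γ)

arcs-permute : (c : Code k) (St : Structure k) → arcs (map (permute c) St) ≡ arcs St
arcs-permute c []       = refl
arcs-permute c (Γ ∷ St) = cong₂ _+_ (∣permute∣ c Γ) (arcs-permute c St)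

-- `C` up to exchanges still pending: only the proof before them is charged to `b`, so a run of
-- exchanges of any length can be recorded at no cost.
record Rearranged (C : Cirquent k) (b : ℕ) : Set where
  constructor rearranged
  field
    {structure′} : Structure k
    {pool′}      : Pool k
    code         : Code k
    pool-eq      : pool C ≡ permute code pool′
    structure-↭  : map (permute code) structure′ ↭ structure C
    proof        : Proof ⟨ structure′ , pool′ ⟩
    bound        : proofSize proof ≤ b

Rearranged-refl : ∀ {b} {C : Cirquent k} (π : Proof C) → proofSize π ≤ b → Rearranged C b
Rearranged-refl {C = C} π π≤ =
  rearranged idCode (sym (permute-id (pool C)))
    (↭-reflexive (trans (map-cong permute-id (structure C)) (map-id (structure C)))) π π≤

-- The pool is permuted first, by at most `k * k` exchanges, then the structure, by at most the
-- square of its length; each cirquent on the way has the size of `C`.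
perform : ∀ {b} {C : Cirquent k} → Rearranged C b →
  Σ[ ρ ∈ Proof C ] proofSize ρ ≤ b + (k * k + List.length (structure C) * List.length (structure C)) * cirquentSize C
perform {k} {b} {⟨ St , _ ⟩} (rearranged {St′} {Pl′} c refl σ π π≤)
  with performCode c St′ Pl′ π | ↭⇒Swaps (map (permute c) St′) St σ
... | ρ , ρ≡ | n , n≤ , w with performOgroupSwaps w ρ
...   | τ , τ≡ = τ , (begin
  proofSize τ                                         ≡⟨ τ≡ ⟩
  proofSize ρ + n * s                                 ≡⟨ cong (_+ n * s) ρ≡ ⟩
  proofSize π + List.length (word c) * cirquentSize ⟨ St′ , Pl′ ⟩ + n * s
    ≡⟨ cong (λ t → proofSize π + List.length (word c) * t + n * s) size-eq ⟩
  proofSize π + List.length (word c) * s + n * s      ≤⟨ +-mono-≤ (+-mono-≤ π≤ (*-monoˡ-≤ s (length-word c))) (*-monoˡ-≤ s n≤′) ⟩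
  b + k * k * s + m * m * s                           ≡⟨ rearrange b (k * k) (m * m) s ⟩
  b + (k * k + m * m) * s                             ∎)
  where
  open ≤-Reasoning
  m = List.length St
  s = cirquentSize ⟨ St , permute c Pl′ ⟩
  size-eq : cirquentSize ⟨ St′ , Pl′ ⟩ ≡ s
  size-eq = cong₂ _+_ (sym (weight-permute c Pl′)) (trans (sym (arcs-permute c St′)) (arcs-↭ σ))
  n≤′ : n ≤ m * m
  n≤′ = ≤-trans n≤ (≤-reflexive (cong (λ t → t * t) (↭-length σ)))
  rearrange : ∀ b x y s → b + x * s + y * s ≡ b + (x + y) * s
  rearrange = solve-∀

-- Discarding mixes with the empty cirquent

-- An empty pool has weight 0, so `ogroups≤weight` rules out ogroups.
empty-pool⇒empty : {C : Cirquent 0} → Proof C → C ≡ ⟨ [] , [] ⟩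
empty-pool⇒empty {⟨ [] , [] ⟩} π = refl
empty-pool⇒empty {⟨ _ ∷ _ , [] ⟩} π with () ← ogroups≤weight π

∥-identityˡ : (D : Cirquent l) → ⟨ [] , [] ⟩ ∥ D ≡ D
∥-identityˡ ⟨ St , Pl ⟩ = cong ⟨_, Pl ⟩ (map-id St)

-- The arities `k + 0` and `k` are not definitionally equal, so the two cirquents have different
-- types; a property is transported along casts instead of an equation.
∥-identityʳ : (P : ∀ {k} → Cirquent k → Set) (C : Cirquent k) → P C → P (C ∥ ⟨ [] , [] ⟩)
∥-identityʳ {k} P ⟨ St , Pl ⟩ p =
  uncast (+-identityʳ k) _ (subst P (cong₂ ⟨_,_⟩ structure-eq (sym (++-identityʳ-eqFree Pl))) p)
  where
  uncast : ∀ {m n} (eq : m ≡ n) (D : Cirquent m) →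
    P ⟨ map (Vec.cast eq) (structure D) , Vec.cast eq (pool D) ⟩ → P D
  uncast refl D = subst P (cong₂ ⟨_,_⟩ (trans (map-cong (cast-is-id refl) _) (map-id _)) (cast-is-id refl _))
  structure-eq : St ≡ map (Vec.cast (+-identityʳ k)) (map (Vec._++ []) St ++ [])
  structure-eq = sym (begin
    map (Vec.cast _) (map (Vec._++ []) St ++ [])   ≡⟨ cong (map (Vec.cast _)) (++-identityʳ _) ⟩
    map (Vec.cast _) (map (Vec._++ []) St)         ≡⟨ map-∘ St ⟨
    map (λ Γ → Vec.cast _ (Γ Vec.++ [])) St        ≡⟨ map-cong ++-identityʳ-eqFree St ⟩
    map (λ Γ → Γ) St                               ≡⟨ map-id St ⟩
    St                                             ∎)
    where open ≡-Reasoning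

-- Counting steps

-- This is 2n - 1 for positive n. On positive arguments the value at a sum exceeds the sum of the
-- values by one, and this surplus pays for a mix.
odd : ℕ → ℕ
odd zero    = 0
odd (suc n) = suc (2 * n)

odd≤ : ∀ n → odd n ≤ 2 * n
odd≤ zero    = z≤n
odd≤ (suc n) = ≤-trans (n≤1+n _) (≤-reflexive (sym (*-suc 2 n)))

odd-< : ∀ {m n} → suc m ≤ n → suc (odd m) ≤ odd n
odd-< {m} {suc n} (s≤s m≤n) = s≤s (≤-trans (odd≤ m) (*-monoʳ-≤ 2 m≤n))

module Bounded (N : ℕ) where

  -- For a derivable cirquent of weight at most `N`, arity and number of ogroups are at most `N`
  -- too. Hence `maxSize` allows `N` for the pool and `N * N` for the arcs, and `maxExchanges`
  -- allows `N * N` for each of the two permutations. `cost` covers one non-exchange step and one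
  -- run of exchanges.
  maxSize maxExchanges cost : ℕ
  maxSize      = N + N * N
  maxExchanges = N * N + N * N
  cost         = suc maxExchanges * maxSize

  -- Bounds the number of non-exchange steps needed to reach a cirquent.  The factor 2 + N * N pays for the loss
  -- of all arcs in a merge; the odd coefficient leaves room for the mixes, one fewer than leaves.
  potential : Cirquent k → ℕ
  potential C = arcs (structure C) + odd (weight (pool C)) * (2 + N * N)

  -- No rule decreases the weight from premise to conclusion, so lightness of the root passes to
  -- every node of a proof.
  Light : Cirquent k → Set
  Light C = weight (pool C) ≤ N

  Cheap : Cirquent k → Set
  Cheap C = Rearranged C (potential C * cost)

  arcs≤N² : {C : Cirquent k} → Proof C → Light C → arcs (structure C) ≤ N * N
  arcs≤N² {C = C} π light = ≤-trans (arcs≤ (structure C))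
    (*-mono-≤ (≤-trans (ogroups≤weight π) light) (≤-trans (arity≤weight (pool C)) light))

  size≤maxSize : {C : Cirquent k} → Proof C → Light C → cirquentSize C ≤ maxSize
  size≤maxSize π light = +-mono-≤ light (arcs≤N² π light)

  performCheap : {C : Cirquent k} → Proof C → Light C → Cheap C →
    Σ[ ρ ∈ Proof C ] proofSize ρ ≤ potential C * cost + maxExchanges * maxSize
  performCheap {C = C} π light cheap with perform cheap
  ... | ρ , ρ≤ = ρ , ≤-trans ρ≤ (+-monoʳ-≤ (potential C * cost)
    (*-mono-≤ (+-mono-≤ (*-mono-≤ k≤N k≤N) (*-mono-≤ m≤N m≤N)) (size≤maxSize π light)))
    where
    k≤N = ≤-trans (arity≤weight (pool C)) light
    m≤N = ≤-trans (ogroups≤weight π) light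

  -- One unit of potential pays for performing the exchanges pending at `C` and for the new cirquent
  -- `D`, after which nothing is pending.
  cheap-step : {C : Cirquent k} {D : Cirquent l} → C ⟶ D → Proof C → Light C → Light D →
    suc (potential C) ≤ potential D → Cheap C → Cheap D
  cheap-step {C = C} {D} r π lightC lightD p≤ cheap with performCheap π lightC cheap
  ... | ρ , ρ≤ = Rearranged-refl (step r ρ) (begin
    cirquentSize D + proofSize ρ                                    ≤⟨ +-mono-≤ (size≤maxSize (step r π) lightD) ρ≤ ⟩
    maxSize + (potential C * cost + maxExchanges * maxSize)         ≡⟨ comm-left maxSize (potential C * cost) _ ⟩
    potential C * cost + cost                                       ≡⟨ +-comm _ cost ⟩
    suc (potential C) * cost                                        ≤⟨ *-monoˡ-≤ cost p≤ ⟩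
    potential D * cost                                              ∎)
    where open ≤-Reasoning

  -- Extra weight contributes at least `2 + N * N`, more than the at most `N * N` arcs of `C`; so
  -- the potential grows even if every arc were lost.
  cheap-heavier : {C : Cirquent k} {D : Cirquent l} → C ⟶ D → Proof C → (Light C → Cheap C) →
    suc (weight (pool C)) ≤ weight (pool D) → Light D → Cheap D
  cheap-heavier {C = C} {D} r π cheap w< lightD = cheap-step r π lightC lightD (begin
    suc (arcs (structure C)) + odd wC * d   ≤⟨ +-monoˡ-≤ _ (≤-trans (s≤s (arcs≤N² π lightC)) (n≤1+n _)) ⟩
    suc (odd wC) * d                        ≤⟨ *-monoˡ-≤ d (odd-< w<) ⟩
    odd (weight (pool D)) * d               ≤⟨ m≤n+m _ (arcs (structure D)) ⟩
    potential D                             ∎) (cheap lightC)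
    where
    open ≤-Reasoning
    d = 2 + N * N
    wC = weight (pool C)
    lightC : Light C
    lightC = ≤-trans (n≤1+n _) (≤-trans w< lightD)

  potential-∥ : (C : Cirquent (suc k)) (D : Cirquent (suc l)) → 2 + (potential C + potential D) ≤ potential (C ∥ D)
  potential-∥ C D = begin
    2 + (aC + odd wC * d + (aD + odd wD * d))   ≡⟨ rearrange aC aD (odd wC) (odd wD) d ⟩
    aC + aD + (2 + (odd wC + odd wD) * d)       ≤⟨ +-mono-≤ (arcs-∥ C D) (+-monoˡ-≤ _ (m≤m+n 2 (N * N))) ⟩
    aCD + suc (odd wC + odd wD) * d             ≡⟨ cong (λ t → aCD + t * d) (odd-+ (weight-pos (pool C)) (weight-pos (pool D))) ⟩
    aCD + odd (wC + wD) * d                     ≡⟨ cong (λ t → aCD + odd t * d) (weight-++ (pool C) (pool D)) ⟨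
    potential (C ∥ D)                           ∎
    where
    open ≤-Reasoning
    aC = arcs (structure C)
    aD = arcs (structure D)
    aCD = arcs (structure (C ∥ D))
    wC = weight (pool C)
    wD = weight (pool D)
    d = 2 + N * N
    rearrange : ∀ a b p q d → 2 + (a + p * d + (b + q * d)) ≡ a + b + (2 + (p + q) * d)
    rearrange = solve-∀
    weight-pos : ∀ {n} (Pl : Pool (suc n)) → 1 ≤ weight Pl
    weight-pos Pl = ≤-trans (s≤s z≤n) (arity≤weight Pl)
    double : ∀ m n → 1 + ((1 + 2 * m) + (1 + 2 * n)) ≡ 1 + 2 * (m + (1 + n))
    double = solve-∀
    odd-+ : ∀ {m n} → 1 ≤ m → 1 ≤ n → suc (odd m + odd n) ≡ odd (m + n)
    odd-+ {suc m} {suc n} _ _ = double m n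

  cheap-mix : {C : Cirquent k} {D : Cirquent l} → Proof C → Proof D →
    (Light C → Cheap C) → (Light D → Cheap D) → Light (C ∥ D) → Cheap (C ∥ D)
  -- A mix with the empty cirquent leaves the potential unchanged, so it could not be paid for; it
  -- is dropped in favour of the other premise.
  cheap-mix {zero} {D = D} π ρ cheapC cheapD light with refl ← empty-pool⇒empty π =
    subst Cheap (sym (∥-identityˡ D)) (cheapD light)
  cheap-mix {suc _} {zero} {C} π ρ cheapC cheapD light with refl ← empty-pool⇒empty ρ =
    ∥-identityʳ Cheap C (cheapC (≤-trans (m≤m+n _ 0) (subst (_≤ N) (weight-++ (pool C) []) light)))
  cheap-mix {suc _} {suc _} {C} {D} π ρ cheapC cheapD light
    with performCheap π lightC (cheapC lightC) | performCheap ρ lightD (cheapD lightD)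
    where
    light′ = subst (_≤ N) (weight-++ (pool C) (pool D)) light
    lightC = ≤-trans (m≤m+n _ _) light′
    lightD = ≤-trans (m≤n+m _ (weight (pool C))) light′
  ... | π′ , π′≤ | ρ′ , ρ′≤ = Rearranged-refl (mix π′ ρ′) (begin
    cirquentSize (C ∥ D) + (proofSize π′ + proofSize ρ′)
      ≤⟨ +-mono-≤ (size≤maxSize (mix π ρ) light) (+-mono-≤ π′≤ ρ′≤) ⟩
    maxSize + (potential C * cost + e + (potential D * cost + e))
      -- A second `maxSize` completes each of the two runs of exchanges, one per premise, to a full
      -- `cost`.
      ≤⟨ m≤n+m _ maxSize ⟩
    maxSize + (maxSize + (potential C * cost + e + (potential D * cost + e)))
      ≡⟨ rearrange maxSize (potential C) (potential D) e ⟩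
    (2 + (potential C + potential D)) * cost
      ≤⟨ *-monoˡ-≤ cost (potential-∥ C D) ⟩
    potential (C ∥ D) * cost ∎)
    where
    open ≤-Reasoning
    e = maxExchanges * maxSize
    rearrange : ∀ s p q e → s + (s + (p * (s + e) + e + (q * (s + e) + e))) ≡ (2 + (p + q)) * (s + e)
    rearrange = solve-∀

  -- Exchanges keep the potential and only update the pending permutations. Each other one-premise
  -- rule raises the potential: ogroup weakening by its new arc, the rest by weight.
  cheap : {C : Cirquent k} → Proof C → Light C → Cheap C
  cheap empty light = Rearranged-refl empty z≤n
  cheap (identity F) light = Rearranged-refl (identity F) (begin
    cirquentSize C         ≤⟨ size≤maxSize (identity F) light ⟩
    maxSize                ≤⟨ m≤m+n maxSize _ ⟩
    cost                   ≡⟨ *-identityˡ cost ⟨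
    -- The two arcs of the axiom make the potential positive.
    1 * cost               ≤⟨ *-monoˡ-≤ cost (s≤s (z≤n {suc (odd (weight (pool C)) * (2 + N * N))})) ⟩
    potential C * cost     ∎)
    where
    open ≤-Reasoning
    C : Cirquent 2
    C = ⟨ ⊤ ∷ [] , dual F ∷ F ∷ [] ⟩
  cheap (mix π ρ) light = cheap-mix π ρ (cheap π) (cheap ρ) light
  cheap (step (oformula-exchange i St Pl) π) light
    with cheap π (subst (_≤ N) (weight-swapAt i Pl) light)
  ... | rearranged {St′} {Pl′} c refl σ π′ π′≤ with swapCode (at i) c
  ...   | d , eq = rearranged d (sym (eq Pl′))
    (↭-trans (↭-reflexive (trans (map-cong eq St′) (map-∘ St′))) (map⁺ (swapAt i) σ))
    π′
    (≤-trans π′≤ (≤-reflexive (cong₂ (λ a w → (a + odd w * (2 + N * N)) * cost)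
      (sym (arcs-swapAt i St)) (sym (weight-swapAt i Pl)))))
  cheap (step (ogroup-exchange Φ Γ Δ Ψ Pl) π) light with cheap π light
  ... | rearranged c eq σ π′ π′≤ = rearranged c eq (↭-trans σ (exchange-↭ Φ Γ Δ Ψ)) π′
    (≤-trans π′≤ (≤-reflexive (cong (λ a → (a + odd (weight Pl) * (2 + N * N)) * cost)
      (arcs-↭ (exchange-↭ Φ Γ Δ Ψ)))))
  cheap (step r@(ogroup-weakening Φ Γ Ψ Pl i i∉Γ) π) light =
    cheap-step r π light light
      (≤-reflexive (cong (_+ odd (weight Pl) * (2 + N * N)) (sym (arcs-weakening Φ Γ Ψ i i∉Γ))))
      (cheap π light)
  cheap (step r@(pool-weakening St Pl i F) π) light =
    cheap-heavier r π (cheap π)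
      (≤-trans (+-monoˡ-≤ (weight Pl) (length-pos F)) (≤-reflexive (sym (weight-insertAt Pl i F)))) light
  cheap (step r@(∨-introduction i St Pl) π) light =
    cheap-heavier r π (cheap π) (≤-reflexive (sym (weight-mergeAt _∨_ (λ _ _ → refl) i Pl))) light
  cheap (step r@(∧-introduction i St Pl _) π) light =
    cheap-heavier r π (cheap π) (≤-reflexive (sym (weight-mergeAt _∧_ (λ _ _ → refl) i Pl))) light

-- The explicit polynomial

-- The expansion of (2 + 2 N (2 + N²)) (1 + 2 N²) (N + N²).
bound-polynomial : Polynomial
bound-polynomial = 0 ∷ 2 ∷ 6 ∷ 8 ∷ 14 ∷ 10 ∷ 4 ∷ 4 ∷ []

eval-bound-polynomial : ∀ N →
  (1 + 2 * N * (2 + N * N)) * (suc (N * N + N * N) * (N + N * N)) + suc (N * N + N * N) * (N + N * N)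
    ≡ 0 + N * (2 + N * (6 + N * (8 + N * (14 + N * (10 + N * (4 + N * (4 + N * 0)))))))
eval-bound-polynomial = solve-∀

theorem3p4 : Σ[ p ∈ Polynomial ] (∀ (F : Formula) → Provable F → Σ[ π ∈ FormulaProof F ] proofSize π ≤ eval p (length F))
theorem3p4 = bound-polynomial , λ F π →
  let N = length F
      open Bounded N
      light = ≤-reflexive (+-identityʳ N)
      ρ , ρ≤ = performCheap π light (cheap π light)
  in ρ , ≤-trans ρ≤ (≤-trans
       -- The root has a single arc, which gives the summand 1 of its potential. The last run of
       -- exchanges is rounded up to one more `cost`.
       (+-mono-≤
         (*-monoˡ-≤ cost (+-monoʳ-≤ 1 (*-monoˡ-≤ (2 + N * N)
           (≤-trans (≤-reflexive (cong odd (+-identityʳ N))) (odd≤ N)))))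
         (m≤n+m (maxExchanges * maxSize) maxSize))
       (≤-reflexive (eval-bound-polynomial N)))
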